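{- Let $K_{m,n}$ be the complete bipartite graph with bipartition $(X,Y)$, $|X|=m$, $|Y|=n$. For integers $s,t$, let $\tau_{s,t}(K_{m,n})$ denote the number of spanning trees of $K_{m,n}$ containing all edges of a given tree $T\subseteq K_{m,n}$ with $|V(T)\cap X|=s$ and $|V(T)\cap Y|=t$ (this number depends only on $s$ and $t$). Then: (1) for any $1\le s\le m$ and $1\le t\le n-1$, $$\frac{\tau_{s,t+1}(K_{m,n})}{\tau_{s,t}(K_{m,n})}=\frac{sn+(m-s)(t+1)}{m[sn+(m-s)t]};$$ (2) for any $1\le s\le m-1$ and $1\le t\le n$, $$\frac{\tau_{s+1,t}(K_{m,n})}{\tau_{s,t}(K_{m,n})}=\frac{tm+(n-t)(s+1)}{n[tm+(n-t)s]}.$$ -}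

module Defs where

open import Data.Nat using (ℕ; zero; suc; _≤_)
open import Data.Bool using (Bool; true)
open import Data.Fin using (Fin; zero; suc; inject₁; fromℕ)
open import Data.Fin.Subset using (Subset; _∈_; ⊤)
open import Data.Vec using (Vec; lookup)
open import Data.Sum using (_⊎_; inj₁; inj₂)
open import Data.Product using (_×_; Σ; ∃)
open import Data.Empty using (⊥)
open import Relation.Nullary using (¬_)
open import Relation.Binary.PropositionalEquality using (_≡_)

Vertex : ℕ → ℕ → Set
Vertex m n = Fin m ⊎ Fin n

-- A set of edges of K_{m,n}: every edge joins some x ∈ X with some y ∈ Y,
-- so an edge set is an m×n 0/1 table.
Edges : ℕ → ℕ → Set
Edges m n = Vec (Vec Bool n) m

HasEdge : ∀ {m n} → Edges m n → Fin m → Fin n → Set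
HasEdge E i j = lookup (lookup E i) j ≡ true

Adj : ∀ {m n} → Edges m n → Vertex m n → Vertex m n → Set
Adj E (inj₁ i) (inj₂ j) = HasEdge E i j
Adj E (inj₂ j) (inj₁ i) = HasEdge E i j
Adj E (inj₁ _) (inj₁ _) = ⊥
Adj E (inj₂ _) (inj₂ _) = ⊥

data Reach {m n} (E : Edges m n) : Vertex m n → Vertex m n → Set where
  here : ∀ {u} → Reach E u u
  step : ∀ {u w v} → Adj E u w → Reach E w v → Reach E u v

IsCycle : ∀ {m n} → Edges m n → (k : ℕ) → (Fin (suc k) → Vertex m n) → Set
IsCycle E k c =
  (2 ≤ k) ×
  (∀ i j → c i ≡ c j → i ≡ j) ×
  (∀ (i : Fin k) → Adj E (c (inject₁ i)) (c (suc i))) ×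
  Adj E (c (fromℕ k)) (c zero)

Acyclic : ∀ {m n} → Edges m n → Set
Acyclic E = ∀ k c → ¬ IsCycle E k c

InV : ∀ {m n} → Subset m → Subset n → Vertex m n → Set
InV VX VY (inj₁ i) = i ∈ VX
InV VX VY (inj₂ j) = j ∈ VY

IsTree : ∀ {m n} → Subset m → Subset n → Edges m n → Set
IsTree {m} {n} VX VY E =
  (∀ i j → HasEdge E i j → (i ∈ VX) × (j ∈ VY)) ×
  (∃ λ (u : Vertex m n) → InV VX VY u) ×
  (∀ u v → InV VX VY u → InV VX VY v → Reach E u v) ×
  Acyclic E

IsSpanningTree : ∀ {m n} → Edges m n → Set
IsSpanningTree S = IsTree ⊤ ⊤ S

_⊆E_ : ∀ {m n} → Edges m n → Edges m n → Set
E ⊆E S = ∀ i j → HasEdge E i j → HasEdge S i j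

HasCount : ∀ {m n} → (Edges m n → Set) → ℕ → Set
HasCount {m} {n} P k =
  Σ (Fin k → Edges m n) λ f →
    (∀ a b → f a ≡ f b → a ≡ b) ×
    (∀ a → P (f a)) ×
    (∀ S → P S → ∃ λ a → f a ≡ S)

NumSpanningTreesContaining : ∀ {m n} → Edges m n → ℕ → Set
NumSpanningTreesContaining T k = HasCount (λ S → IsSpanningTree S × (T ⊆E S)) k

{-# OPTIONS --safe #-}
module Submission where

-- Let a = m − s and b = n − t count the vertices outside T. The spanning trees S ⊇ T are counted by
-- following, in S, the route from a vertex v ∉ T to T one edge at a time. Suppose the part P of the
-- route already known ends in h ∈ X. The next vertex either lies in T, and then S contains the larger
-- tree T ∪ P, or it is one of the remaining vertices of Y, and the known part grows. By induction on the
-- number of vertices outside T ∪ P, if a′ and b′ of them lie in X and Y, the number of such S is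
-- (mt + sb′) nᵃ′ mᵇ′⁻¹, whatever the size of P. The case P = {v} gives τ_{s,t} = (mt + sb) nᵃ⁻¹ mᵇ⁻¹,
-- and mt + sb = sn + (m − s)t. Since a or b may vanish, both counts are stated multiplied by m and mn.

open import Defs
open import Data.Bool using (Bool; true; false)
import Data.Bool as Bool
open import Data.Empty using (⊥; ⊥-elim)
open import Data.Fin using (Fin; zero; suc; inject₁; fromℕ; toℕ; splitAt; _↑ˡ_; _↑ʳ_)
import Data.Fin as Fin
open import Data.Fin.Properties using (any?; injective⇒≤; suc-injective; splitAt-↑ˡ; splitAt-↑ʳ; splitAt⁻¹-↑ˡ; splitAt⁻¹-↑ʳ; toℕ-inject₁)
open import Data.Fin.Relation.Unary.Top using (view; ‵fromℕ; ‵inject₁)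
import Data.Fin.Subset as Subset
open import Data.Fin.Subset using (Subset; ∣_∣)
open import Data.Fin.Subset.Properties using (∈⊤)
open import Data.List using (List; []; _∷_)
open import Data.List.Membership.Propositional using (_∈_)
open import Data.List.Relation.Unary.All using (All; []; _∷_)
import Data.List.Relation.Unary.All as All
open import Data.List.Relation.Unary.Any using (here; there)
open import Data.List.Relation.Unary.AllPairs using ([]; _∷_)
import Data.List.Relation.Unary.Linked as Linked
open import Data.List.Relation.Unary.Linked using (Linked; [-]; _∷_)
open import Data.List.Relation.Unary.Unique.Propositional using (Unique)
open import Data.Nat using (ℕ; zero; suc; _+_; _*_; _∸_; _^_; _≤_; z≤n; s≤s; s≤s⁻¹; NonZero)
open import Data.Nat.Properties using (≤-antisym; ≤-trans; ≤-reflexive; m≢1+n+m; +-suc; +-comm; +-identityʳ; *-identityʳ; ≤-refl; m+n∸m≡n; m+[n∸m]≡n; +-∸-assoc; *-zeroʳ; *-assoc; *-cancelˡ-≡)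
open import Data.Nat.Tactic.RingSolver using (solve-∀)
open import Data.Product using (∃; _×_; _,_; proj₁; proj₂)
open import Data.Sum using (_⊎_; inj₁; inj₂)
import Data.Sum as Sum
open import Data.Sum.Properties using (≡-dec)
open import Data.Unit using (⊤; tt)
open import Data.Vec using (Vec; []; _∷_; lookup; _[_]≔_)
open import Data.Vec.Properties using (lookup∘update; lookup∘update′; []=⇒lookup; lookup⇒[]=)
open import Function using (_∘_; id; it)
open import Relation.Binary.PropositionalEquality using (_≡_; _≢_; refl; sym; trans; cong; cong₂; subst; module ≡-Reasoning)
open import Relation.Nullary using (¬_; Dec; yes; no; contradiction)
open import Algebra.Properties.Semiring.Sum Data.Nat.Properties.+-*-semiring using (sum; sum-cong-≗; *-distribˡ-sum)

private
  variable
    m n k l : ℕ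

-- Counting

-- Each `f a` satisfies `P`, so the other enumeration lists it at some index. Distinct `a` get
-- distinct indices, and the pigeonhole principle applies.
count-≤ : {P : Edges m n → Set} → HasCount P k → HasCount P l → k ≤ l
count-≤ (f , f-inj , f-P , _) (g , _ , _ , g-onto) =
  injective⇒≤ {f = λ a → proj₁ (g-onto (f a) (f-P a))} λ {a} {b} eq →
    f-inj a b (trans (sym (proj₂ (g-onto (f a) (f-P a))))
              (trans (cong g eq) (proj₂ (g-onto (f b) (f-P b)))))

count-unique : {P : Edges m n → Set} → HasCount P k → HasCount P l → k ≡ l
count-unique p q = ≤-antisym (count-≤ p q) (count-≤ q p)

count-cong : {P Q : Edges m n → Set} →
  (∀ {S} → P S → Q S) → (∀ {S} → Q S → P S) → HasCount P k → HasCount Q k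
count-cong to from (f , f-inj , f-P , f-onto) =
  f , f-inj , (λ a → to (f-P a)) , λ S q → f-onto S (from q)

count-∅ : {P : Edges m n → Set} → (∀ {S} → ¬ P S) → HasCount P 0
count-∅ ¬p = (λ ()) , (λ ()) , (λ ()) , λ _ p → contradiction p ¬p

count-singleton : {P : Edges m n → Set} {T : Edges m n} →
  P T → (∀ {S} → P S → T ≡ S) → HasCount P 1
count-singleton {T = T} p unique =
  (λ _ → T) , (λ { zero zero _ → refl }) , (λ _ → p) , λ _ q → zero , unique q

count-⊎ : {P Q : Edges m n → Set} → (∀ {S} → P S → Q S → ⊥) →
  HasCount P k → HasCount Q l → HasCount (λ S → P S ⊎ Q S) (k + l)
count-⊎ {k = k} {l = l} {P} {Q} disjoint (f , f-inj , f-P , f-onto) (g , g-inj , g-Q , g-onto) =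
  h ∘ splitAt k , h-inj , (λ a → h-PQ (splitAt k a)) , h-onto
  where
  h : Fin k ⊎ Fin l → _
  h = Sum.[ f , g ]
  h-PQ : ∀ a → P (h a) ⊎ Q (h a)
  h-PQ (inj₁ a) = inj₁ (f-P a)
  h-PQ (inj₂ a) = inj₂ (g-Q a)
  h-inj : ∀ a b → h (splitAt k a) ≡ h (splitAt k b) → a ≡ b
  h-inj a b eq with splitAt k a in eqa | splitAt k b in eqb
  ... | inj₁ x | inj₁ y = trans (sym (splitAt⁻¹-↑ˡ eqa)) (trans (cong (_↑ˡ l) (f-inj x y eq)) (splitAt⁻¹-↑ˡ eqb))
  ... | inj₁ x | inj₂ y = ⊥-elim (disjoint (f-P x) (subst Q (sym eq) (g-Q y)))
  ... | inj₂ x | inj₁ y = ⊥-elim (disjoint (f-P y) (subst Q eq (g-Q x)))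
  ... | inj₂ x | inj₂ y = trans (sym (splitAt⁻¹-↑ʳ eqa)) (trans (cong (k ↑ʳ_) (g-inj x y eq)) (splitAt⁻¹-↑ʳ eqb))
  h-onto : ∀ S → P S ⊎ Q S → ∃ λ a → h (splitAt k a) ≡ S
  h-onto S (inj₁ p) with a , eq ← f-onto S p = a ↑ˡ l , trans (cong h (splitAt-↑ˡ k a l)) eq
  h-onto S (inj₂ q) with a , eq ← g-onto S q = k ↑ʳ a , trans (cong h (splitAt-↑ʳ k l a)) eq

count-∃ : ∀ {d} {P : Fin d → Edges m n → Set} (ks : Fin d → ℕ) →
  (∀ {a b S} → P a S → P b S → a ≡ b) → (∀ a → HasCount (P a) (ks a)) →
  HasCount (λ S → ∃ λ a → P a S) (sum ks)
count-∃ {d = zero}  ks _ _ = count-∅ λ ()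
count-∃ {d = suc d} {P} ks disjoint counts = count-cong
  Sum.[ (zero ,_) , (λ (a , p) → suc a , p) ]
  (λ { (zero , p) → inj₁ p ; (suc a , p) → inj₂ (a , p) })
  (count-⊎ (λ p (a , q) → zero≢suc (disjoint p q)) (counts zero)
    (count-∃ (ks ∘ suc) (λ p q → suc-injective (disjoint p q)) (counts ∘ suc)))
  where
  zero≢suc : {a : Fin d} → zero ≡ suc a → ⊥
  zero≢suc ()

-- Edges and walks

_≟_ : (u v : Vertex m n) → Dec (u ≡ v)
_≟_ = ≡-dec Fin._≟_ Fin._≟_

Opposite : Vertex m n → Vertex m n → Set
Opposite (inj₁ _) (inj₂ _) = ⊤
Opposite (inj₂ _) (inj₁ _) = ⊤
Opposite (inj₁ _) (inj₁ _) = ⊥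
Opposite (inj₂ _) (inj₂ _) = ⊥

opposite-sym : (u v : Vertex m n) → Opposite u v → Opposite v u
opposite-sym (inj₁ _) (inj₂ _) _ = tt
opposite-sym (inj₂ _) (inj₁ _) _ = tt

adj-sym : ∀ {E : Edges m n} u v → Adj E u v → Adj E v u
adj-sym (inj₁ _) (inj₂ _) e = e
adj-sym (inj₂ _) (inj₁ _) e = e

adj⇒opposite : ∀ {E : Edges m n} u v → Adj E u v → Opposite u v
adj⇒opposite (inj₁ _) (inj₂ _) _ = tt
adj⇒opposite (inj₂ _) (inj₁ _) _ = tt

adj? : (E : Edges m n) (u v : Vertex m n) → Dec (Adj E u v)
adj? E (inj₁ i) (inj₂ j) = lookup (lookup E i) j Bool.≟ true
adj? E (inj₂ j) (inj₁ i) = lookup (lookup E i) j Bool.≟ true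
adj? E (inj₁ _) (inj₁ _) = no λ ()
adj? E (inj₂ _) (inj₂ _) = no λ ()

adj-mono : ∀ {E S : Edges m n} → E ⊆E S → ∀ u v → Adj E u v → Adj S u v
adj-mono E⊆S (inj₁ i) (inj₂ j) = E⊆S i j
adj-mono E⊆S (inj₂ j) (inj₁ i) = E⊆S i j

lookup-ext : ∀ {A : Set} (xs ys : Vec A n) → (∀ i → lookup xs i ≡ lookup ys i) → xs ≡ ys
lookup-ext []       []       _  = refl
lookup-ext (x ∷ xs) (y ∷ ys) eq = cong₂ _∷_ (eq zero) (lookup-ext xs ys (eq ∘ suc))

⊆E-antisym : {E S : Edges m n} → E ⊆E S → S ⊆E E → E ≡ S
⊆E-antisym {E = E} {S} E⊆S S⊆E =
  lookup-ext E S λ i → lookup-ext (lookup E i) (lookup S i) λ j → entry i j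
  where
  entry : ∀ i j → lookup (lookup E i) j ≡ lookup (lookup S i) j
  entry i j with lookup (lookup E i) j in e | lookup (lookup S i) j in s
  ... | true  | true  = refl
  ... | false | false = refl
  ... | true  | false = trans (sym (E⊆S i j e)) s
  ... | false | true  = trans (sym e) (S⊆E i j s)

insert : Edges m n → Fin m → Fin n → Edges m n
insert E i j = E [ i ]≔ (lookup E i [ j ]≔ true)

insert-elim : ∀ (E : Edges m n) i j i′ j′ → HasEdge (insert E i j) i′ j′ →
  HasEdge E i′ j′ ⊎ (i′ ≡ i × j′ ≡ j)
insert-elim E i j i′ j′ e with i′ Fin.≟ i
... | no i′≢i = inj₁ (subst (λ row → lookup row j′ ≡ true) (lookup∘update′ i′≢i E _) e)
... | yes refl with subst (λ row → lookup row j′ ≡ true) (lookup∘update i E _) e | j′ Fin.≟ j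
...   | _  | yes refl = inj₂ (refl , refl)
...   | e′ | no j′≢j = inj₁ (trans (sym (lookup∘update′ j′≢j (lookup E i) true)) e′)

insert-⊇ : ∀ (E : Edges m n) i j → E ⊆E insert E i j
insert-⊇ E i j i′ j′ e with i′ Fin.≟ i
... | no i′≢i = subst (λ row → lookup row j′ ≡ true) (sym (lookup∘update′ i′≢i E _)) e
... | yes refl = subst (λ row → lookup row j′ ≡ true) (sym (lookup∘update i E _)) in-row
  where
  in-row : lookup (lookup E i [ j ]≔ true) j′ ≡ true
  in-row with j′ Fin.≟ j
  ... | yes refl = lookup∘update j (lookup E i) true
  ... | no j′≢j = trans (lookup∘update′ j′≢j (lookup E i) true) e

insert-new : ∀ (E : Edges m n) i j → HasEdge (insert E i j) i j
insert-new E i j = trans (cong (λ row → lookup row j) (lookup∘update i E _)) (lookup∘update j (lookup E i) true)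

-- Junk value: when u and v lie on the same side, no edge is added.
addEdge : Edges m n → Vertex m n → Vertex m n → Edges m n
addEdge E (inj₁ i) (inj₂ j) = insert E i j
addEdge E (inj₂ j) (inj₁ i) = insert E i j
addEdge E (inj₁ _) (inj₁ _) = E
addEdge E (inj₂ _) (inj₂ _) = E

addEdge-elim : ∀ {E : Edges m n} u v x y → Adj (addEdge E u v) x y →
  Adj E x y ⊎ (x ≡ u × y ≡ v) ⊎ (x ≡ v × y ≡ u)
addEdge-elim {E = E} (inj₁ i) (inj₂ j) (inj₁ i′) (inj₂ j′) e =
  Sum.map₂ (λ { (refl , refl) → inj₁ (refl , refl) }) (insert-elim E i j i′ j′ e)
addEdge-elim {E = E} (inj₁ i) (inj₂ j) (inj₂ j′) (inj₁ i′) e =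
  Sum.map₂ (λ { (refl , refl) → inj₂ (refl , refl) }) (insert-elim E i j i′ j′ e)
addEdge-elim {E = E} (inj₂ j) (inj₁ i) (inj₁ i′) (inj₂ j′) e =
  Sum.map₂ (λ { (refl , refl) → inj₂ (refl , refl) }) (insert-elim E i j i′ j′ e)
addEdge-elim {E = E} (inj₂ j) (inj₁ i) (inj₂ j′) (inj₁ i′) e =
  Sum.map₂ (λ { (refl , refl) → inj₁ (refl , refl) }) (insert-elim E i j i′ j′ e)
addEdge-elim (inj₁ _) (inj₁ _) x y e = inj₁ e
addEdge-elim (inj₂ _) (inj₂ _) x y e = inj₁ e

addEdge-⊇ : ∀ (E : Edges m n) u v → E ⊆E addEdge E u v
addEdge-⊇ E (inj₁ i) (inj₂ j) = insert-⊇ E i j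
addEdge-⊇ E (inj₂ j) (inj₁ i) = insert-⊇ E i j
addEdge-⊇ E (inj₁ _) (inj₁ _) = λ _ _ → id
addEdge-⊇ E (inj₂ _) (inj₂ _) = λ _ _ → id

addEdge-new : ∀ (E : Edges m n) u v → Opposite u v → Adj (addEdge E u v) u v
addEdge-new E (inj₁ i) (inj₂ j) _ = insert-new E i j
addEdge-new E (inj₂ j) (inj₁ i) _ = insert-new E i j

addEdge-⊆ : ∀ {E S : Edges m n} u v → E ⊆E S → Adj S u v → addEdge E u v ⊆E S
addEdge-⊆ {S = S} u v E⊆S e i j new with addEdge-elim u v (inj₁ i) (inj₂ j) new
... | inj₁ old = E⊆S i j old
... | inj₂ (inj₁ (refl , refl)) = e
... | inj₂ (inj₂ (refl , refl)) = e

-- Unlike `Reach`, this keeps a predicate at every vertex, both ends included, so that walks inside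
-- a tree and walks that avoid a vertex or a route have one type.
data Walk (E : Edges m n) (Q : Vertex m n → Set) : Vertex m n → Vertex m n → Set where
  stop : ∀ {u} → Q u → Walk E Q u u
  go   : ∀ {u w v} → Q u → Adj E u w → Walk E Q w v → Walk E Q u v

module _ {E : Edges m n} where

  walk-map : ∀ {S : Edges m n} {Q R : Vertex m n → Set} {u v} →
    E ⊆E S → (∀ {x} → Q x → R x) → Walk E Q u v → Walk S R u v
  walk-map E⊆S f (stop q)           = stop (f q)
  walk-map E⊆S f (go {u} {w} q e p) = go (f q) (adj-mono E⊆S u w e) (walk-map E⊆S f p)

  walk-start : ∀ {Q : Vertex m n → Set} {u v} → Walk E Q u v → Q u
  walk-start (stop q)   = q
  walk-start (go q _ _) = q

  walk-++ : ∀ {Q : Vertex m n → Set} {u v w} → Walk E Q u v → Walk E Q v w → Walk E Q u w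
  walk-++ (stop _)   p = p
  walk-++ (go q e r) p = go q e (walk-++ r p)

  walk-reverse : ∀ {Q : Vertex m n → Set} {u v} → Walk E Q u v → Walk E Q v u
  walk-reverse (stop q)           = stop q
  walk-reverse (go {u} {w} q e p) =
    walk-++ (walk-reverse p) (go (walk-start p) (adj-sym u w e) (stop q))

  -- The tail is searched first, so the visit found is the last one and what follows it never meets
  -- `x`. The left alternative covers a walk that misses `x` altogether.
  last-visit : ∀ {Q : Vertex m n → Set} {u v} x → v ≢ x → Walk E Q u v →
    Walk E (λ y → Q y × y ≢ x) u v ⊎ (∃ λ w → Adj E x w × Walk E (λ y → Q y × y ≢ x) w v)
  last-visit x v≢x (stop q) = inj₁ (stop (q , v≢x))
  last-visit x v≢x (go {u} {w} q e p) with last-visit x v≢x p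
  ... | inj₂ found = inj₂ found
  ... | inj₁ p′ with u ≟ x
  ...   | yes refl = inj₂ (w , e , p′)
  ...   | no u≢x = inj₁ (go (q , u≢x) e p′)

  leave : ∀ {Q : Vertex m n → Set} {u v} → v ≢ u → Walk E Q u v →
    ∃ λ w → Adj E u w × Walk E (λ y → Q y × y ≢ u) w v
  leave {u = u} v≢u p with last-visit u v≢u p
  ... | inj₂ found = found
  ... | inj₁ p′ = contradiction refl (proj₂ (walk-start p′))

  reach⇒walk : ∀ {u v} → Reach E u v → Walk E (λ _ → ⊤) u v
  reach⇒walk here       = stop tt
  reach⇒walk (step e p) = go tt e (reach⇒walk p)

  walk⇒reach : ∀ {Q : Vertex m n → Set} {u v} → Walk E Q u v → Reach E u v
  walk⇒reach (stop _)   = here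
  walk⇒reach (go _ e p) = step e (walk⇒reach p)

-- Cycles

-- Indexed in the same way as `IsCycle`, so that a simple path of length at least 2 is a cycle as
-- soon as its two ends are adjacent.
record SimplePath (E : Edges m n) (Q : Vertex m n → Set) (u v : Vertex m n) : Set where
  constructor simplePath
  field
    len   : ℕ
    at    : Fin (suc len) → Vertex m n
    start : at zero ≡ u
    end   : at (fromℕ len) ≡ v
    inj   : ∀ i j → at i ≡ at j → i ≡ j
    edge  : ∀ (i : Fin len) → Adj E (at (inject₁ i)) (at (suc i))
    all   : ∀ i → Q (at i)

module _ {E : Edges m n} {Q : Vertex m n → Set} where

  suffix : ∀ {u v} (p : SimplePath E Q u v) i → SimplePath E Q (SimplePath.at p i) v
  suffix (simplePath len at _ end inj edge all) zero = simplePath len at refl end inj edge all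
  suffix (simplePath (suc len) at _ end inj edge all) (suc i) =
    suffix (simplePath len (at ∘ suc) refl end (λ a b eq → suc-injective (inj (suc a) (suc b) eq))
      (edge ∘ suc) (all ∘ suc)) i

  prepend : ∀ {u w v} → Q u → Adj E u w → (p : SimplePath E Q w v) →
    (∀ i → SimplePath.at p i ≢ u) → SimplePath E Q u v
  prepend {u} q e (simplePath len at refl end inj edge all) fresh =
    simplePath (suc len) at′ refl end inj′ edge′ λ { zero → q ; (suc i) → all i }
    where
    at′ : Fin (suc (suc len)) → Vertex _ _
    at′ zero    = u
    at′ (suc i) = at i
    inj′ : ∀ i j → at′ i ≡ at′ j → i ≡ j
    inj′ zero    zero    _  = refl
    inj′ zero    (suc j) eq = contradiction (sym eq) (fresh j)
    inj′ (suc i) zero    eq = contradiction eq (fresh i)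
    inj′ (suc i) (suc j) eq = cong suc (inj i j eq)
    edge′ : ∀ i → Adj E (at′ (inject₁ i)) (at′ (suc i))
    edge′ zero    = e
    edge′ (suc i) = edge i

  walk⇒simplePath : ∀ {u v} → Walk E Q u v → SimplePath E Q u v
  walk⇒simplePath {u} (stop q) =
    simplePath 0 (λ _ → u) refl refl (λ { zero zero _ → refl }) (λ ()) (λ _ → q)
  walk⇒simplePath {u} (go q e p) with walk⇒simplePath p
  ... | p′ with any? (λ i → SimplePath.at p′ i ≟ u)
  -- The vertex `u` recurs at position `i`, and the loop before it is erased.
  ...   | yes (i , refl) = suffix p′ i
  ...   | no fresh = prepend q e p′ λ i eq → fresh (i , eq)

-- If `u` and `v` differed, a simple path between them off `h`, with `h` put in front, would be
-- closed into a cycle by the edge from `v` to `h`.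
acyclic⇒no-detour : ∀ {E : Edges m n} → Acyclic E → ∀ {h u v} →
  Adj E h u → Adj E h v → Walk E (_≢ h) u v → u ≡ v
acyclic⇒no-detour {E = E} acyclic {h} {u} {v} hu hv p with walk⇒simplePath p
... | simplePath zero _ refl refl _ _ _ = refl
... | simplePath (suc l) at refl refl inj edge avoids =
  -- The path from `u` to `v` has `l + 1` edges and the edge from `h` is one more, which gives the
  -- bound `2 ≤ k` of `IsCycle`.
  ⊥-elim (acyclic (2 + l) P.at (s≤s (s≤s z≤n) , P.inj , P.edge , adj-sym h v hv))
  where
  module P = SimplePath (prepend {Q = λ _ → ⊤} tt hu (simplePath (suc l) at refl refl inj edge λ _ → tt) avoids)

-- As numbers, the two equations read j = i + 1 and i = j + 1, hence i = i + 2. This keeps the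
-- predecessor and the successor of a position on a cycle apart.
inject₁≢suc : ∀ {k} {i j : Fin k} → inject₁ j ≡ suc i → inject₁ i ≢ suc j
inject₁≢suc {i = i} {j} eq eq′ = m≢1+n+m (toℕ i) (begin
  toℕ i              ≡⟨ toℕ-inject₁ i ⟨
  toℕ (inject₁ i)    ≡⟨ cong toℕ eq′ ⟩
  suc (toℕ j)        ≡⟨ cong suc (toℕ-inject₁ j) ⟨
  suc (toℕ (inject₁ j)) ≡⟨ cong (suc ∘ toℕ) eq ⟩
  suc (suc (toℕ i))  ∎)
  where open ≡-Reasoning

-- The two neighbours are the predecessor and the successor, read cyclically: `zero` wraps round to
-- the last position and the last position to `zero`. They are distinct because `2 ≤ k`.
cycle-neighbours : ∀ {E : Edges m n} {k c} → IsCycle E k c → ∀ i →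
  ∃ λ a → ∃ λ b → a ≢ b × Adj E (c i) (c a) × Adj E (c i) (c b)
cycle-neighbours {k = suc zero} (s≤s () , _) _
cycle-neighbours {k = suc (suc k)} {c} (_ , _ , edge , close) zero =
  suc zero , fromℕ _ , (λ ()) , edge zero , adj-sym (c (fromℕ (2 + k))) (c zero) close
cycle-neighbours {k = suc (suc k)} {c} (_ , _ , edge , close) (suc i) with suc i in eq | view (suc i)
... | _ | ‵fromℕ with refl ← eq =
  inject₁ i , zero , (λ ()) , adj-sym (c (inject₁ i)) (c (suc i)) (edge i) , close
... | _ | ‵inject₁ j = inject₁ i , suc j , inject₁≢suc (sym eq) ,
  subst (λ x → Adj _ (c x) (c (inject₁ i))) eq (adj-sym (c (inject₁ i)) (c (suc i)) (edge i)) , edge j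

-- Trees

-- The vertex set is a predicate, to be read off a colouring. `inside` speaks of one end of an edge
-- only, since `Adj` is symmetric.
record Tree (R : Vertex m n → Set) (T : Edges m n) : Set where
  field
    inside  : ∀ u v → Adj T u v → R u
    conn    : ∀ {u v} → R u → R v → Walk T R u v
    acyclic : Acyclic T

open Tree

tree-cong : ∀ {R R′ : Vertex m n → Set} {T} →
  (∀ {x} → R x → R′ x) → (∀ {x} → R′ x → R x) → Tree R T → Tree R′ T
tree-cong to from t = record
  { inside  = λ u v e → to (inside t u v e)
  ; conn    = λ p q → walk-map (λ _ _ → id) to (conn t (from p) (from q))
  ; acyclic = acyclic t
  }

-- A cycle through `p` would give `p` two distinct neighbours, but `r` is its only one. A cycle that
-- misses `p` already lies in `T`.
addLeaf : ∀ {R : Vertex m n → Set} {T r p} → Tree R T → R r → ¬ R p → Opposite r p →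
  Tree (λ x → R x ⊎ x ≡ p) (addEdge T r p)
addLeaf {m} {n} {R} {T} {r} {p} t Rr ¬Rp opp = record
  { inside = inside′ ; conn = conn′ ; acyclic = acyclic′ }
  where
  T′ = addEdge T r p
  R′ : Vertex m n → Set
  R′ x = R x ⊎ x ≡ p

  inside′ : ∀ u v → Adj T′ u v → R′ u
  inside′ u v e with addEdge-elim r p u v e
  ... | inj₁ old              = inj₁ (inside t u v old)
  ... | inj₂ (inj₁ (refl , _)) = inj₁ Rr
  ... | inj₂ (inj₂ (eq , _))   = inj₂ eq

  leaf-walk : ∀ {u} → R u → Walk T′ R′ u p
  leaf-walk Ru = walk-++ (walk-map (addEdge-⊇ T r p) inj₁ (conn t Ru Rr))
    (go (inj₁ Rr) (addEdge-new T r p opp) (stop (inj₂ refl)))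

  conn′ : ∀ {u v} → R′ u → R′ v → Walk T′ R′ u v
  conn′ (inj₁ Ru)   (inj₁ Rv)   = walk-map (addEdge-⊇ T r p) inj₁ (conn t Ru Rv)
  conn′ (inj₁ Ru)   (inj₂ refl) = leaf-walk Ru
  conn′ (inj₂ refl) (inj₁ Rv)   = walk-reverse (leaf-walk Rv)
  conn′ (inj₂ refl) (inj₂ refl) = stop (inj₂ refl)

  leaf-neighbour : ∀ x → Adj T′ p x → x ≡ r
  leaf-neighbour x e with addEdge-elim r p p x e
  ... | inj₁ old              = contradiction (inside t p x old) ¬Rp
  ... | inj₂ (inj₁ (refl , _)) = contradiction Rr ¬Rp
  ... | inj₂ (inj₂ (_ , eq))   = eq

  old-edge : ∀ {x y} → x ≢ p → y ≢ p → Adj T′ x y → Adj T x y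
  old-edge {x} {y} x≢p y≢p e with addEdge-elim r p x y e
  ... | inj₁ old               = old
  ... | inj₂ (inj₁ (_ , y≡p))  = contradiction y≡p y≢p
  ... | inj₂ (inj₂ (x≡p , _))  = contradiction x≡p x≢p

  acyclic′ : Acyclic T′
  acyclic′ k c cyc@(2≤k , inj , edge , close) with any? (λ i → c i ≟ p)
  ... | yes (i , refl) with a , b , a≢b , ea , eb ← cycle-neighbours cyc i =
    a≢b (inj a b (trans (leaf-neighbour (c a) ea) (sym (leaf-neighbour (c b) eb))))
  ... | no fresh = acyclic t k c (2≤k , inj , (λ i → old-edge (avoid _) (avoid _) (edge i)) ,
                                  old-edge (avoid _) (avoid _) close)
    where
    avoid : ∀ i → c i ≢ p
    avoid i eq = fresh (i , eq)

-- The vertices of `ps` are added as leaves in turn, each serving as the next point of attachment.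
-- The last two components trade "contains `T` and runs along the path" for "contains one larger
-- tree".
attach : ∀ {R : Vertex m n → Set} {T r} ps → Tree R T → R r →
  Linked Opposite (r ∷ ps) → Unique ps → All (λ p → ¬ R p) ps →
  ∃ λ T′ → Tree (λ x → R x ⊎ x ∈ ps) T′ ×
    (∀ {S} → T′ ⊆E S → T ⊆E S × Linked (Adj S) (r ∷ ps)) ×
    (∀ {S} → T ⊆E S → Linked (Adj S) (r ∷ ps) → T′ ⊆E S)
attach [] t Rr _ _ _ =
  _ , tree-cong inj₁ (λ { (inj₁ Rx) → Rx }) t , (λ T⊆S → T⊆S , [-]) , λ T⊆S _ → T⊆S
attach {R = R} {T} {r} (p ∷ ps) t Rr (opp ∷ opps) (p≢ ∷ unique) (¬Rp ∷ ¬Rps)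
  with T′ , t′ , T′⊆⇒ , ⇒T′⊆ ←
    attach ps (addLeaf t Rr ¬Rp opp) (inj₂ refl) opps unique
      (All.zipWith (λ { (_ , ¬Rx) (inj₁ Rx) → ¬Rx Rx ; (p≢x , _) (inj₂ refl) → p≢x refl }) (p≢ , ¬Rps))
  = T′ , tree-cong to from t′ ,
    (λ T′⊆S → let T+⊆S , links = T′⊆⇒ T′⊆S in
      (λ i j e → T+⊆S i j (addEdge-⊇ T r p i j e)) ,
      adj-mono T+⊆S r p (addEdge-new T r p opp) ∷ links) ,
    λ { T⊆S (e ∷ links) → ⇒T′⊆ (addEdge-⊆ r p T⊆S e) links }
  where
  to : ∀ {x} → (R x ⊎ x ≡ p) ⊎ x ∈ ps → R x ⊎ x ∈ (p ∷ ps)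
  to (inj₁ (inj₁ Rx))   = inj₁ Rx
  to (inj₁ (inj₂ refl)) = inj₂ (here refl)
  to (inj₂ x∈ps)        = inj₂ (there x∈ps)
  from : ∀ {x} → R x ⊎ x ∈ (p ∷ ps) → (R x ⊎ x ≡ p) ⊎ x ∈ ps
  from (inj₁ Rx)           = inj₁ (inj₁ Rx)
  from (inj₂ (here eq))    = inj₁ (inj₂ eq)
  from (inj₂ (there x∈ps)) = inj₂ x∈ps

-- The walk in `T` between the ends of an edge of `S` leaves the first end for good through some
-- `w`. Since `S` has no detours, `w` is the other end, so the edge is in `T`.
spanning⇒maximal : ∀ {R : Vertex m n → Set} {T S} → Tree R T → (∀ x → R x) →
  Acyclic S → T ⊆E S → S ⊆E T
spanning⇒maximal {T = T} {S} t full acyclicS T⊆S i j e with adj? T (inj₁ i) (inj₂ j)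
... | yes old = old
... | no new with w , e′ , p ← leave (λ ()) (conn t (full (inj₁ i)) (full (inj₂ j))) =
  contradiction (subst (Adj T (inj₁ i)) w≡y e′) new
  where
  w≡y : w ≡ inj₂ j
  w≡y = acyclic⇒no-detour acyclicS (adj-mono T⊆S (inj₁ i) w e′) e (walk-map T⊆S proj₂ p)

-- Colourings

-- `tree` marks the vertices of `T`, `path` those of the known part of the route, `free` all others.
data Colour : Set where
  tree path free : Colour

free≢tree : free ≢ tree
free≢tree ()

free≢path : free ≢ path
free≢path ()

tree≢path : tree ≢ path
tree≢path ()

indicator : Colour → Colour → ℕ
indicator tree tree = 1
indicator path path = 1
indicator free free = 1
indicator _    _    = 0

indicator-≢ : ∀ {κ l} → l ≢ κ → indicator κ l ≡ 0
indicator-≢ {tree} {tree} l≢κ = contradiction refl l≢κ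
indicator-≢ {tree} {path} _ = refl
indicator-≢ {tree} {free} _ = refl
indicator-≢ {path} {tree} _ = refl
indicator-≢ {path} {path} l≢κ = contradiction refl l≢κ
indicator-≢ {path} {free} _ = refl
indicator-≢ {free} {tree} _ = refl
indicator-≢ {free} {path} _ = refl
indicator-≢ {free} {free} l≢κ = contradiction refl l≢κ

number : ∀ {d} → Colour → (Fin d → Colour) → ℕ
number κ f = sum (λ a → indicator κ (f a))

number-cong : ∀ {d} κ (f g : Fin d → Colour) → (∀ a → f a ≡ g a) → number κ f ≡ number κ g
number-cong κ f g f≗g = sum-cong-≗ λ a → cong (indicator κ) (f≗g a)

number-none : ∀ {d} κ {f : Fin d → Colour} → (∀ a → f a ≢ κ) → number κ f ≡ 0
number-none {zero}  κ _ = refl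
number-none {suc d} κ f≢κ = cong₂ _+_ (indicator-≢ (f≢κ zero)) (number-none κ (f≢κ ∘ suc))

sum-by-colour : ∀ {d} (w : Colour → ℕ) (f : Fin d → Colour) →
  sum (w ∘ f) ≡ number tree f * w tree + number path f * w path + number free f * w free
sum-by-colour {zero}  w f = refl
sum-by-colour {suc d} w f = trans (cong (w (f zero) +_) (sum-by-colour w (f ∘ suc))) (add (f zero))
  where
  t = number tree (f ∘ suc)
  p = number path (f ∘ suc)
  q = number free (f ∘ suc)
  add : ∀ κ → w κ + (t * w tree + p * w path + q * w free) ≡
    (indicator tree κ + t) * w tree + (indicator path κ + p) * w path + (indicator free κ + q) * w free
  add tree = add₁ t p q (w tree) (w path) (w free)
    where
    add₁ : ∀ t p q x y z → x + (t * x + p * y + q * z) ≡ (1 + t) * x + p * y + q * z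
    add₁ = solve-∀
  add path = add₂ t p q (w tree) (w path) (w free)
    where
    add₂ : ∀ t p q x y z → y + (t * x + p * y + q * z) ≡ t * x + (1 + p) * y + q * z
    add₂ = solve-∀
  add free = add₃ t p q (w tree) (w path) (w free)
    where
    add₃ : ∀ t p q x y z → z + (t * x + p * y + q * z) ≡ t * x + p * y + (1 + q) * z
    add₃ = solve-∀

number-total : ∀ {d} (f : Fin d → Colour) → number tree f + number path f + number free f ≡ d
number-total {d} f = begin
  number tree f + number path f + number free f
    ≡⟨ cong₂ _+_ (cong₂ _+_ (*-identityʳ (number tree f)) (*-identityʳ (number path f))) (*-identityʳ (number free f)) ⟨
  number tree f * 1 + number path f * 1 + number free f * 1
    ≡⟨ sum-by-colour (λ _ → 1) f ⟨
  sum {d} (λ _ → 1)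
    ≡⟨ ones d ⟩
  d ∎
  where
  open ≡-Reasoning
  ones : ∀ d → sum {d} (λ _ → 1) ≡ d
  ones zero    = refl
  ones (suc d) = cong suc (ones d)

number-total-pathless : ∀ {d} (f : Fin d → Colour) → (∀ a → f a ≢ path) →
  number tree f + number free f ≡ d
number-total-pathless {d} f f≢path = begin
  number tree f + number free f                 ≡⟨ cong (_+ number free f) (+-identityʳ (number tree f)) ⟨
  number tree f + 0 + number free f             ≡⟨ cong (λ p → number tree f + p + number free f) (number-none path f≢path) ⟨
  number tree f + number path f + number free f ≡⟨ number-total f ⟩
  d                                             ∎
  where open ≡-Reasoning

number-marked : ∀ {d} (f g : Fin d → Colour) a → f a ≡ free → g a ≡ path →
  (∀ b → b ≢ a → g b ≡ f b) →
  number free f ≡ suc (number free g) × number tree g ≡ number tree f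
number-marked f g zero fa ga same rewrite fa | ga =
  cong suc (number-cong free (f ∘ suc) (g ∘ suc) λ b → sym (same (suc b) λ ())) ,
  number-cong tree (g ∘ suc) (f ∘ suc) λ b → same (suc b) λ ()
number-marked f g (suc a) fa ga same rewrite same zero (λ ())
  with eqfree , eqtree ← number-marked (f ∘ suc) (g ∘ suc) a fa ga
         (λ b b≢a → same (suc b) (b≢a ∘ suc-injective)) =
  trans (cong (indicator free (f zero) +_) eqfree) (+-suc _ _) , cong (indicator tree (f zero) +_) eqtree

-- The recolouring for a route that has reached `T`, when both merge into one tree.
absorb : Colour → Colour
absorb tree = tree
absorb path = tree
absorb free = free

absorb≢path : ∀ κ → absorb κ ≢ path
absorb≢path tree ()
absorb≢path path ()
absorb≢path free ()

number-absorb-free : ∀ {d} (f : Fin d → Colour) → number free (absorb ∘ f) ≡ number free f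
number-absorb-free f = sum-cong-≗ (λ a → unchanged (f a))
  where
  unchanged : ∀ κ → indicator free (absorb κ) ≡ indicator free κ
  unchanged tree = refl
  unchanged path = refl
  unchanged free = refl

number-absorb-tree : ∀ {d} (f : Fin d → Colour) →
  number tree (absorb ∘ f) ≡ number tree f + number path f
number-absorb-tree {d} f = begin
  number tree (absorb ∘ f)
    ≡⟨ sum-by-colour (indicator tree ∘ absorb) f ⟩
  number tree f * 1 + number path f * 1 + number free f * 0
    ≡⟨ ring-step (number tree f) (number path f) (number free f) ⟩
  number tree f + number path f ∎
  where
  open ≡-Reasoning
  ring-step : ∀ t p q → t * 1 + p * 1 + q * 0 ≡ t + p
  ring-step = solve-∀

Colouring : ℕ → ℕ → Set
Colouring m n = Vertex m n → Colour

mark : Colouring m n → Vertex m n → Colouring m n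
mark c v x with x ≟ v
... | yes _ = path
... | no _  = c x

mark-self : ∀ (c : Colouring m n) v → mark c v v ≡ path
mark-self c v with v ≟ v
... | yes _ = refl
... | no v≢v = contradiction refl v≢v

mark-other : ∀ (c : Colouring m n) v x → x ≢ v → mark c v x ≡ c x
mark-other c v x x≢v with x ≟ v
... | yes x≡v = contradiction x≡v x≢v
... | no _ = refl

mark-≢path : ∀ (c : Colouring m n) {v x} → mark c v x ≢ path → c x ≢ path × x ≢ v
mark-≢path c {v} {x} ≢path with x ≟ v
... | yes _ = contradiction refl ≢path
... | no x≢v = ≢path , x≢v

mark-tree : ∀ (c : Colouring m n) {v x} → mark c v x ≡ tree → c x ≡ tree
mark-tree c {v} {x} eq with x ≟ v
... | no _ = eq

-- The two sides of the bipartition, relative to a vertex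

-- The head of the route changes sides at every step. Measuring from the head lets one computation
-- serve both sides.
own opp : Vertex m n → ℕ
own {m} {n} (inj₁ _) = m
own {m} {n} (inj₂ _) = n
opp {m} {n} (inj₁ _) = n
opp {m} {n} (inj₂ _) = m

ownV : (v : Vertex m n) → Fin (own v) → Vertex m n
ownV (inj₁ _) = inj₁
ownV (inj₂ _) = inj₂

oppV : (v : Vertex m n) → Fin (opp v) → Vertex m n
oppV (inj₁ _) = inj₂
oppV (inj₂ _) = inj₁

oppV-onto : ∀ (v u : Vertex m n) → Opposite v u → ∃ λ a → oppV v a ≡ u
oppV-onto (inj₁ _) (inj₂ j) _ = j , refl
oppV-onto (inj₂ _) (inj₁ i) _ = i , refl

oppV-injective : ∀ (v : Vertex m n) {a b} → oppV v a ≡ oppV v b → a ≡ b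
oppV-injective (inj₁ _) refl = refl
oppV-injective (inj₂ _) refl = refl

oppV-opposite : ∀ (v : Vertex m n) a → Opposite v (oppV v a)
oppV-opposite (inj₁ _) _ = tt
oppV-opposite (inj₂ _) _ = tt

own# opp# : Colouring m n → Vertex m n → Colour → ℕ
own# c v κ = number κ (c ∘ ownV v)
opp# c v κ = number κ (c ∘ oppV v)

own-mark : ∀ (c : Colouring m n) v → c v ≡ free →
  own# c v free ≡ suc (own# (mark c v) v free) × own# (mark c v) v tree ≡ own# c v tree
own-mark c v@(inj₁ i) cv = number-marked _ _ i cv (mark-self c v)
  λ b b≢i → mark-other c v (inj₁ b) λ { refl → b≢i refl }
own-mark c v@(inj₂ j) cv = number-marked _ _ j cv (mark-self c v)
  λ b b≢j → mark-other c v (inj₂ b) λ { refl → b≢j refl }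

opp-mark : ∀ (c : Colouring m n) v κ → opp# (mark c v) v κ ≡ opp# c v κ
opp-mark c v@(inj₁ _) κ = number-cong κ _ (c ∘ oppV v) λ b → mark-other c v (oppV v b) λ ()
opp-mark c v@(inj₂ _) κ = number-cong κ _ (c ∘ oppV v) λ b → mark-other c v (oppV v b) λ ()

frees : Colouring m n → ℕ
frees c = number free (c ∘ inj₁) + number free (c ∘ inj₂)

frees≡own+opp : ∀ (c : Colouring m n) v → frees c ≡ own# c v free + opp# c v free
frees≡own+opp c (inj₁ _) = refl
frees≡own+opp c (inj₂ _) = +-comm (number free (c ∘ inj₁)) _

frees-mark : ∀ (c : Colouring m n) v → c v ≡ free → frees c ≡ suc (frees (mark c v))
frees-mark c v cv = begin
  frees c                                               ≡⟨ frees≡own+opp c v ⟩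
  own# c v free + opp# c v free                         ≡⟨ cong₂ _+_ (proj₁ (own-mark c v cv)) (sym (opp-mark c v free)) ⟩
  suc (own# (mark c v) v free + opp# (mark c v) v free) ≡⟨ cong suc (frees≡own+opp (mark c v) v) ⟨
  suc (frees (mark c v))                                ∎
  where open ≡-Reasoning

-- Arithmetic of the counting formulas

*-swap : ∀ x y z → x * (y * z) ≡ y * (x * z)
*-swap = solve-∀

-- Here `M` and `N` are the sizes of the sides, `s` and `t` the numbers of tree vertices, `a` and
-- `b` those of free vertices. The value is `M * N` times the count for a tree, and `M` times the
-- count for a route with its head on the side of size `M`.
formula : (M N s t a b : ℕ) → ℕ
formula M N s t a b = (M * t + s * b) * (N ^ a * M ^ b)

formula-at : Colouring m n → Vertex m n → ℕ
formula-at c v = formula (own v) (opp v) (own# c v tree) (opp# c v tree) (own# c v free) (opp# c v free)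

-- Both first factors expand to `s * t + a * t + s * b`.
formula-sym : ∀ s t a b → formula (s + a) (t + b) s t a b ≡ formula (t + b) (s + a) t s b a
formula-sym s t a b = lemma s t a b ((t + b) ^ a) ((s + a) ^ b)
  where
  lemma : ∀ s t a b x y →
    ((s + a) * t + s * b) * (x * y) ≡ ((t + b) * s + t * a) * (y * x)
  lemma = solve-∀

formula-suc : ∀ M N s t a b → N * formula M N s t a b ≡ formula M N s t (suc a) b
formula-suc M N s t a b = lemma N (M * t + s * b) (N ^ a) (M ^ b)
  where
  lemma : ∀ N z x y → N * (z * (x * y)) ≡ z * ((N * x) * y)
  lemma = solve-∀

-- This is the recursion for a route, scaled by `M * N`: of the candidates for the next vertex, `t`
-- lie in `T`, `q` lie on the route and give nothing, and `b` are free and become a head on the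
-- other side. Apart from the common powers, `t * (s + p) * b` and `b * t * a` add up to
-- `M * t * b`, which leaves `N * (M * t + s * b)`.
formula-step : ∀ s p a t q b → let M = s + p + a; N = t + q + b in
  t * formula M N (s + p) (t + q) a b + q * 0 + b * (M * formula N M t s (b ∸ 1) a) ≡
  N * formula M N s t a b
formula-step s p a t q b = begin
  t * formula M N (s + p) (t + q) a b + q * 0 + b * (M * formula N M t s (b ∸ 1) a)
    ≡⟨ cong (t * formula M N (s + p) (t + q) a b + q * 0 +_) (shift b) ⟩
  t * formula M N (s + p) (t + q) a b + q * 0 + b * ((N * s + t * a) * (N ^ a * M ^ b))
    ≡⟨ lemma s p a t q b (N ^ a) (M ^ b) ⟩
  N * formula M N s t a b ∎
  where
  open ≡-Reasoning
  M = s + p + a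
  N = t + q + b
  -- For `b = 0` the outer factor kills the term with the truncated `b ∸ 1`; otherwise the factor
  -- `M` supplies the missing power.
  shift : ∀ b → b * (M * formula N M t s (b ∸ 1) a) ≡ b * ((N * s + t * a) * (N ^ a * M ^ b))
  shift zero    = refl
  shift (suc b) = cong (suc b *_) (shift-lemma M (N * s + t * a) (M ^ b) (N ^ a))
    where
    shift-lemma : ∀ M z x y → M * (z * (x * y)) ≡ z * (y * (M * x))
    shift-lemma = solve-∀
  lemma : ∀ s p a t q b x y →
    t * (((s + p + a) * (t + q) + (s + p) * b) * (x * y)) + q * 0 +
      b * (((t + q + b) * s + t * a) * (x * y)) ≡
    (t + q + b) * (((s + p + a) * t + s * b) * (x * y))
  lemma = solve-∀

formula-at-mark : ∀ (c : Colouring m n) v → c v ≡ free → formula-at (mark c v) v ≡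
  formula (own v) (opp v) (own# c v tree) (opp# c v tree) (own# c v free ∸ 1) (opp# c v free)
formula-at-mark c v cv
  rewrite proj₁ (own-mark c v cv) | proj₂ (own-mark c v cv) | opp-mark c v tree | opp-mark c v free = refl

formula-at-absorb : ∀ (c : Colouring m n) v → formula-at (absorb ∘ c) v ≡
  formula (own v) (opp v) (own# c v tree + own# c v path) (opp# c v tree + opp# c v path)
    (own# c v free) (opp# c v free)
formula-at-absorb c v
  rewrite number-absorb-tree (c ∘ ownV v) | number-absorb-tree (c ∘ oppV v)
        | number-absorb-free (c ∘ ownV v) | number-absorb-free (c ∘ oppV v) = refl

-- Without path vertices each side consists of tree and free vertices only, so its size has the form
-- that `formula-sym` asks for.
formula-at-indep : ∀ (c : Colouring m n) → (∀ x → c x ≢ path) → ∀ v w →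
  formula-at c v ≡ formula-at c w
formula-at-indep {m} {n} c no-path = λ where
    (inj₁ _) (inj₁ _) → refl
    (inj₁ _) (inj₂ _) → sides
    (inj₂ _) (inj₁ _) → sym sides
    (inj₂ _) (inj₂ _) → refl
  where
  s = number tree (c ∘ inj₁)
  t = number tree (c ∘ inj₂)
  a = number free (c ∘ inj₁)
  b = number free (c ∘ inj₂)
  sides : formula m n s t a b ≡ formula n m t s b a
  sides = subst (λ (M , N) → formula M N s t a b ≡ formula N M t s b a)
    (cong₂ _,_ (number-total-pathless (c ∘ inj₁) (no-path ∘ inj₁)) (number-total-pathless (c ∘ inj₂) (no-path ∘ inj₂)))
    (formula-sym s t a b)

-- Spanning trees containing a tree and a path

Contains : Edges m n → Edges m n → Set
Contains T S = IsSpanningTree S × T ⊆E S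

Escapes : Colouring m n → Edges m n → Vertex m n → Set
Escapes c S u = ∃ λ r → c r ≡ tree × Walk S (λ x → c x ≢ path) u r

-- These are the trees in which the route goes on from `h` to `u`: among the neighbours of `h` in
-- `S`, `Escapes` picks the one on the way to `T`.
Leaves : Colouring m n → Edges m n → Vertex m n → List (Vertex m n) → Vertex m n → Edges m n → Set
Leaves c T h ps u S =
  IsSpanningTree S × T ⊆E S × Linked (Adj S) (h ∷ ps) × Adj S h u × Escapes c S u

-- The part of the route found so far is h ∷ ps, most recent vertex first.
record State (c : Colouring m n) (T : Edges m n) (h : Vertex m n) (ps : List (Vertex m n)) : Set where
  field
    isTree    : Tree (λ x → c x ≡ tree) T
    opposites : Linked Opposite (h ∷ ps)
    unique    : Unique (h ∷ ps)
    coloured  : All (λ x → c x ≡ path) (h ∷ ps)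
    listed    : ∀ {x} → c x ≡ path → x ∈ (h ∷ ps)

everywhere : (u : Vertex m n) → InV Subset.⊤ Subset.⊤ u
everywhere (inj₁ _) = ∈⊤
everywhere (inj₂ _) = ∈⊤

spanning-connected : {S : Edges m n} → IsSpanningTree S → ∀ u v → Reach S u v
spanning-connected (_ , _ , connected , _) u v = connected u v (everywhere u) (everywhere v)

spanning-acyclic : {S : Edges m n} → IsSpanningTree S → Acyclic S
spanning-acyclic (_ , _ , _ , acyc) = acyc

tree⇒spanning : ∀ {R : Vertex m n → Set} {T} → Tree R T → (∀ x → R x) → Vertex m n → IsSpanningTree T
tree⇒spanning {T = T} t full u =
  (λ _ _ _ → ∈⊤ , ∈⊤) , (u , everywhere u) ,
  (λ v w _ _ → walk⇒reach (conn t (full v) (full w))) , acyclic t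

-- Both vertices reach `T` off the route, and `T` itself is off the route, so they are joined by a
-- walk that misses `h`. Two such neighbours of `h` coincide in an acyclic graph.
leaves-unique : ∀ {c : Colouring m n} {T h ps} → State c T h ps → ∀ {u v S} →
  Leaves c T h ps u S → Leaves c T h ps v S → u ≡ v
leaves-unique {c = c} {h = h} st {u} {v}
  (sp , T⊆S , _ , hu , r , cr , p) (_ , _ , _ , hv , r′ , cr′ , p′) =
  acyclic⇒no-detour (spanning-acyclic sp) hu hv
    (walk-map (λ _ _ → id) (λ { ≢path refl → ≢path (All.head coloured) })
      (walk-++ p (walk-++ (walk-map T⊆S (λ eq eq′ → tree≢path (trans (sym eq) eq′)) (conn isTree cr cr′))
        (walk-reverse p′))))
  where
  open State st

-- The walk is cut at its last visit to `u`; the rest avoids `u` as well and thus survives the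
-- marking of `u`.
escape-marked : ∀ {c : Colouring m n} {S u} → c u ≡ free →
  ∀ {r} → c r ≡ tree → Walk S (λ x → c x ≢ path) u r → ∃ λ w → Adj S u w × Escapes (mark c u) S w
escape-marked {c = c} {u = u} cu {r} cr p
  with w , e , p′ ← leave (λ { refl → free≢tree (trans (sym cu) cr) }) p =
  w , e , r , trans (mark-other c u r (λ { refl → free≢tree (trans (sym cu) cr) })) cr ,
  walk-map (λ _ _ → id) (λ {x} (≢path , x≢u) eq → ≢path (trans (sym (mark-other c u x x≢u)) eq)) p′

escape-unmarked : ∀ {c : Colouring m n} {S u w} → c u ≡ free →
  Adj S u w → Escapes (mark c u) S w → Escapes c S u
escape-unmarked {c = c} cu e (r , cr , p) =
  r , mark-tree c cr ,
  go (λ eq → free≢path (trans (sym cu) eq)) e (walk-map (λ _ _ → id) (proj₁ ∘ mark-≢path c) p)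

tree-mark : ∀ {c : Colouring m n} {T v} → c v ≡ free →
  Tree (λ x → c x ≡ tree) T → Tree (λ x → mark c v x ≡ tree) T
tree-mark {c = c} {v = v} cv = tree-cong
  (λ {x} eq → trans (mark-other c v x λ { refl → free≢tree (trans (sym cv) eq) }) eq)
  (mark-tree c)

mark-path : ∀ (c : Colouring m n) v {x} → c x ≡ path → mark c v x ≡ path
mark-path c v {x} eq with x ≟ v
... | yes _ = refl
... | no _  = eq

mark-path⁻ : ∀ (c : Colouring m n) v {x} → mark c v x ≡ path → x ≡ v ⊎ c x ≡ path
mark-path⁻ c v {x} eq with x ≟ v
... | yes x≡v = inj₁ x≡v
... | no _    = inj₂ eq

start : ∀ {c : Colouring m n} {T v} → Tree (λ x → c x ≡ tree) T →
  (∀ x → c x ≢ path) → c v ≡ free → State (mark c v) T v []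
start {c = c} {v = v} t no-path cv = record
  { isTree    = tree-mark cv t
  ; opposites = [-]
  ; unique    = [] ∷ []
  ; coloured  = mark-self c v ∷ []
  ; listed    = λ {x} eq → Sum.[ here , (λ eq′ → contradiction eq′ (no-path x)) ] (mark-path⁻ c v eq)
  }

extend : ∀ {c : Colouring m n} {T h ps u} → State c T h ps → c u ≡ free → Opposite h u →
  State (mark c u) T u (h ∷ ps)
extend {c = c} {h = h} {u = u} st cu hu = record
  { isTree    = tree-mark cu isTree
  ; opposites = opposite-sym h u hu ∷ opposites
  ; unique    = All.map (λ cx → λ { refl → free≢path (trans (sym cu) cx) }) coloured ∷ unique
  ; coloured  = mark-self c u ∷ All.map (mark-path c u) coloured
  ; listed    = λ {x} eq → Sum.[ here , (λ eq′ → there (listed eq′)) ] (mark-path⁻ c u {x} eq)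
  }
  where
  open State st

-- The route has arrived at `r` in `T`, so it is hung on `T` there as a chain of leaves. Escape from
-- `r` is then the walk of length zero.
absorb-path : ∀ {c : Colouring m n} {T h ps r} → State c T h ps → c r ≡ tree → Opposite h r →
  ∃ λ T′ → Tree (λ x → absorb (c x) ≡ tree) T′ ×
    (∀ {S} → Contains T′ S → Leaves c T h ps r S) × (∀ {S} → Leaves c T h ps r S → Contains T′ S)
absorb-path {c = c} {h = h} {ps} {r} st cr hr
  with T′ , t′ , T′⊆⇒ , ⇒T′⊆ ← attach (h ∷ ps) (State.isTree st) cr (opposite-sym h r hr ∷ State.opposites st) (State.unique st)
         (All.map (λ cx cx′ → tree≢path (trans (sym cx′) cx)) (State.coloured st))
  = T′ , tree-cong to from t′ ,
    (λ (sp , T′⊆S) → let T⊆S , links = T′⊆⇒ T′⊆S in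
      sp , T⊆S , Linked.tail links , adj-sym r h (Linked.head links) ,
      r , cr , stop (λ eq → tree≢path (trans (sym cr) eq))) ,
    (λ (sp , T⊆S , links , e , _) → sp , ⇒T′⊆ T⊆S (adj-sym h r e ∷ links))
  where
  open State st
  to : ∀ {x} → c x ≡ tree ⊎ x ∈ (h ∷ ps) → absorb (c x) ≡ tree
  to (inj₁ eq)  = cong absorb eq
  to (inj₂ x∈) = cong absorb (All.lookup coloured x∈)
  from : ∀ {x} → absorb (c x) ≡ tree → c x ≡ tree ⊎ x ∈ (h ∷ ps)
  from {x} eq with c x in cx
  ... | tree = inj₁ refl
  ... | path = inj₂ (listed cx)

-- The mutual induction for trees and routes

module _ {m n : ℕ} {{_ : NonZero m}} {{_ : NonZero n}} where

  -- The bound `f` on the number of free vertices is the induction variable. `TreeCount` gives its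
  -- equation at every `h`, so that it can be read from either side.
  TreeCount PathCount : ℕ → Set
  TreeCount f = ∀ {c : Colouring m n} {T} → Tree (λ x → c x ≡ tree) T → (∃ λ r → c r ≡ tree) →
    (∀ x → c x ≢ path) → frees c ≤ f →
    ∃ λ k → HasCount (Contains T) k × (∀ h → opp h * (own h * k) ≡ formula-at c h)
  PathCount f = ∀ {c : Colouring m n} {T h ps} → State c T h ps → frees c ≤ f →
    ∃ λ k → HasCount (λ S → ∃ λ u → Leaves c T h ps u S) k × own h * k ≡ formula-at c h

  -- The base case: `T` already spans, so by maximality it is the only tree counted, and the formula
  -- reduces to the product of the two sizes.
  spanning-count : ∀ {c : Colouring m n} {T} → Tree (λ x → c x ≡ tree) T → (∃ λ r → c r ≡ tree) →
    (∀ x → c x ≡ tree) →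
    ∃ λ k → HasCount (Contains T) k × (∀ h → opp h * (own h * k) ≡ formula-at c h)
  spanning-count {c} {T} t (r , _) full = 1 ,
    count-singleton (tree⇒spanning t full r , λ _ _ → id)
      (λ (sp , T⊆S) → ⊆E-antisym T⊆S (spanning⇒maximal t full (spanning-acyclic sp) T⊆S)) ,
    value
    where
    none : ∀ {κ} → tree ≢ κ → ∀ {d} (f : Fin d → Vertex m n) → number κ (c ∘ f) ≡ 0
    none tree≢κ f = number-none _ λ a eq → tree≢κ (trans (sym (full (f a))) eq)
    all-tree : ∀ {d} (f : Fin d → Vertex m n) → number tree (c ∘ f) ≡ d
    all-tree f = begin
      number tree (c ∘ f)                       ≡⟨ +-identityʳ _ ⟨
      number tree (c ∘ f) + 0                   ≡⟨ cong (number tree (c ∘ f) +_) (none (λ ()) f) ⟨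
      number tree (c ∘ f) + number free (c ∘ f) ≡⟨ number-total-pathless (c ∘ f) (λ a eq → tree≢path (trans (sym (full (f a))) eq)) ⟩
      _ ∎
      where open ≡-Reasoning
    value : ∀ h → opp h * (own h * 1) ≡ formula-at c h
    value h rewrite none {free} (λ ()) (ownV h) | none {free} (λ ()) (oppV h)
                  | all-tree (ownV h) | all-tree (oppV h) = ring-step (own h) (opp h)
      where
      ring-step : ∀ M N → N * (M * 1) ≡ (M * N + M * 0) * (1 * 1)
      ring-step = solve-∀

  free? : (c : Colouring m n) → Dec (∃ λ v → c v ≡ free)
  free? c with any? (λ i → isFree? (c (inj₁ i))) | any? (λ j → isFree? (c (inj₂ j)))
    where
    isFree? : ∀ κ → Dec (κ ≡ free)
    isFree? tree = no λ ()
    isFree? path = no λ ()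
    isFree? free = yes refl
  ... | yes (i , eq) | _            = yes (inj₁ i , eq)
  ... | no _         | yes (j , eq) = yes (inj₂ j , eq)
  ... | no ¬i        | no ¬j        = no λ { (inj₁ i , eq) → ¬i (i , eq) ; (inj₂ j , eq) → ¬j (j , eq) }

  -- A route is started at the free vertex `v`. Every spanning tree connects `v` to `T`, so no tree
  -- is lost by asking that the route go on.
  treeCount-step : ∀ {c : Colouring m n} {T v} → Tree (λ x → c x ≡ tree) T → (∃ λ r → c r ≡ tree) →
    (∀ x → c x ≢ path) → c v ≡ free →
    (∃ λ k → HasCount (λ S → ∃ λ u → Leaves (mark c v) T v [] u S) k × own v * k ≡ formula-at (mark c v) v) →
    ∃ λ k → HasCount (Contains T) k × (∀ h → opp h * (own h * k) ≡ formula-at c h)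
  treeCount-step {c} {T} {v} t (r , cr) no-path cv (k , counted , eq) =
    k , count-cong (λ (_ , sp , T⊆S , _) → sp , T⊆S) from counted , value
    where
    from : ∀ {S} → Contains T S → ∃ λ u → Leaves (mark c v) T v [] u S
    from (sp , T⊆S)
      with w , e , esc ← escape-marked cv cr
             (walk-map (λ _ _ → id) (λ {x} _ → no-path x) (reach⇒walk (spanning-connected sp v r)))
      = w , sp , T⊆S , [-] , e , esc
    at-v : opp v * (own v * k) ≡ formula-at c v
    at-v = begin
      opp v * (own v * k)
        ≡⟨ cong (opp v *_) (trans eq (formula-at-mark c v cv)) ⟩
      opp v * formula (own v) (opp v) (own# c v tree) (opp# c v tree) (own# c v free ∸ 1) (opp# c v free)
        ≡⟨ formula-suc (own v) (opp v) (own# c v tree) (opp# c v tree) (own# c v free ∸ 1) (opp# c v free) ⟩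
      formula (own v) (opp v) (own# c v tree) (opp# c v tree) (suc (own# c v free ∸ 1)) (opp# c v free)
        -- The vertex `v` is itself free, so the truncated subtraction loses nothing.
        ≡⟨ cong (λ a → formula (own v) (opp v) (own# c v tree) (opp# c v tree) a (opp# c v free))
             (trans (cong (λ a → suc (a ∸ 1)) (proj₁ (own-mark c v cv))) (sym (proj₁ (own-mark c v cv)))) ⟩
      formula-at c v ∎
      where open ≡-Reasoning
    product-indep : ∀ u w → opp u * (own u * k) ≡ opp w * (own w * k)
    product-indep (inj₁ _) (inj₁ _) = refl
    product-indep (inj₁ _) (inj₂ _) = *-swap n m k
    product-indep (inj₂ _) (inj₁ _) = *-swap m n k
    product-indep (inj₂ _) (inj₂ _) = refl
    value : ∀ h → opp h * (own h * k) ≡ formula-at c h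
    value h = trans (product-indep h v) (trans at-v (formula-at-indep c no-path v h))

  formula-at-oppV : ∀ (c : Colouring m n) h a → c (oppV h a) ≡ free → ∀ k →
    own (oppV h a) * k ≡ formula-at (mark c (oppV h a)) (oppV h a) →
    opp h * k ≡ formula (opp h) (own h) (opp# c h tree) (own# c h tree) (opp# c h free ∸ 1) (own# c h free)
  formula-at-oppV c (inj₁ _) a cu k eq = trans eq (formula-at-mark c (inj₂ a) cu)
  formula-at-oppV c (inj₂ _) a cu k eq = trans eq (formula-at-mark c (inj₁ a) cu)

  opp-nonZero : ∀ (h : Vertex m n) → NonZero (opp h)
  opp-nonZero (inj₁ _) = it
  opp-nonZero (inj₂ _) = it

  -- The tree count is assumed at the same `f`, since absorbing the route leaves the number of free
  -- vertices unchanged. Only a lengthened route lowers it.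
  module _ {f : ℕ} {c : Colouring m n} {T h ps} (st : State c T h ps) (bound : frees c ≤ f)
    (treeCount : TreeCount f)
    (pathCount : ∀ {u} → c u ≡ free → Opposite h u →
      ∃ λ k → HasCount (λ S → ∃ λ w → Leaves (mark c u) T u (h ∷ ps) w S) k ×
              own u * k ≡ formula-at (mark c u) u) where

    private
      M = own h
      N = opp h
      s = own# c h tree
      p = own# c h path
      a = own# c h free
      t = opp# c h tree
      q = opp# c h path
      b = opp# c h free

    -- `N * M` times the number of trees in one branch, by the colour of the next vertex.
    weight : Colour → ℕ
    weight tree = formula M N (s + p) (t + q) a b
    weight path = 0
    weight free = M * formula N M t s (b ∸ 1) a

    -- A next vertex on the route is impossible, because the escaping walk starts there. One in `T`
    -- closes the route into a larger tree, and a free one lengthens the route.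
    branch-count : ∀ x → ∃ λ k → HasCount (Leaves c T h ps (oppV h x)) k × N * (M * k) ≡ weight (c (oppV h x))
    branch-count x with c (oppV h x) in cu
    ... | path = 0 , count-∅ (λ (_ , _ , _ , _ , _ , _ , w) → walk-start w cu) ,
      trans (cong (N *_) (*-zeroʳ M)) (*-zeroʳ N)
    ... | tree with T′ , t′ , to , from ← absorb-path st cu (oppV-opposite h x)
               with k , counted , eq ← treeCount t′ (_ , cong absorb cu) (absorb≢path ∘ c)
                      (≤-trans (≤-reflexive (cong₂ _+_ (number-absorb-free (c ∘ inj₁)) (number-absorb-free (c ∘ inj₂)))) bound)
      = k , count-cong to from counted , trans (eq h) (formula-at-absorb c h)
    ... | free with k , counted , eq ← pathCount cu (oppV-opposite h x)
      = k , count-cong to from counted , trans (*-swap N M k) (cong (M *_) (formula-at-oppV c h x cu k eq))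
      where
      u = oppV h x
      to : ∀ {S} → (∃ λ w → Leaves (mark c u) T u (h ∷ ps) w S) → Leaves c T h ps u S
      to (w , sp , T⊆S , links , e , esc) =
        sp , T⊆S , Linked.tail links , adj-sym u h (Linked.head links) , escape-unmarked cu e esc
      from : ∀ {S} → Leaves c T h ps u S → ∃ λ w → Leaves (mark c u) T u (h ∷ ps) w S
      from (sp , T⊆S , links , e , _ , cr , walk)
        with w , e′ , esc ← escape-marked cu cr walk
        = w , sp , T⊆S , adj-sym h u e ∷ links , e′ , esc

    -- The next vertex lies opposite `h` and is determined by `S`, so the branches partition the
    -- trees and their counts add up. The common factor `N` is cancelled at the end.
    pathCount-step : ∃ λ k → HasCount (λ S → ∃ λ u → Leaves c T h ps u S) k × own h * k ≡ formula-at c h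
    pathCount-step = sum ks , count-cong to from
        (count-∃ ks (λ l l′ → oppV-injective h (leaves-unique st l l′)) (proj₁ ∘ proj₂ ∘ branch-count)) ,
      *-cancelˡ-≡ _ _ N {{opp-nonZero h}} scaled
      where
      ks : Fin N → ℕ
      ks = proj₁ ∘ branch-count
      to : ∀ {S} → (∃ λ x → Leaves c T h ps (oppV h x) S) → ∃ λ u → Leaves c T h ps u S
      to (x , l) = oppV h x , l
      from : ∀ {S} → (∃ λ u → Leaves c T h ps u S) → ∃ λ x → Leaves c T h ps (oppV h x) S
      from (u , l@(_ , _ , _ , e , _)) with x , refl ← oppV-onto h u (adj⇒opposite h u e) = x , l
      scaled : N * (M * sum ks) ≡ N * formula M N s t a b
      scaled = begin
        N * (M * sum ks)                   ≡⟨ *-assoc N M (sum ks) ⟨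
        N * M * sum ks                     ≡⟨ *-distribˡ-sum (N * M) ks ⟩
        sum (λ x → N * M * ks x)           ≡⟨ sum-cong-≗ (λ x → trans (*-assoc N M (ks x)) (proj₂ (proj₂ (branch-count x)))) ⟩
        sum (weight ∘ c ∘ oppV h)          ≡⟨ sum-by-colour weight (c ∘ oppV h) ⟩
        t * weight tree + q * 0 + b * weight free
          ≡⟨ subst (λ (M , N) → t * formula M N (s + p) (t + q) a b + q * 0 + b * (M * formula N M t s (b ∸ 1) a)
                               ≡ N * formula M N s t a b)
               (cong₂ _,_ (number-total (c ∘ ownV h)) (number-total (c ∘ oppV h)))
               (formula-step s p a t q b) ⟩
        N * formula M N s t a b            ∎
        where open ≡-Reasoning

  mark-bound : ∀ (c : Colouring m n) v {f} → c v ≡ free → frees c ≤ f → suc (frees (mark c v)) ≤ f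
  mark-bound c v cv = ≤-trans (≤-reflexive (sym (frees-mark c v cv)))

  -- `treeCount` at `suc f` calls `pathCount` at `f`. `pathCount` calls `treeCount` at its own bound
  -- and itself at a smaller one, so every cycle of calls lowers the bound.
  treeCount : ∀ f → TreeCount f
  pathCount : ∀ f → PathCount f

  treeCount f {c} t root no-path bound with free? c
  treeCount f {c} t root no-path bound | no none = spanning-count t root all-tree
    where
    all-tree : ∀ x → c x ≡ tree
    all-tree x with c x in cx
    ... | tree = refl
    ... | path = contradiction cx (no-path x)
    ... | free = contradiction (x , cx) none
  treeCount zero    {c} t root no-path bound | yes (v , cv) with () ← mark-bound c v cv bound
  treeCount (suc f) {c} t root no-path bound | yes (v , cv) =
    treeCount-step t root no-path cv (pathCount f (start t no-path cv) (s≤s⁻¹ (mark-bound c v cv bound)))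

  pathCount f {c} {T} {h} {ps} st bound = pathCount-step st bound (treeCount f) (next f bound)
    where
    next : ∀ f → frees c ≤ f → ∀ {u} → c u ≡ free → Opposite h u →
      ∃ λ k → HasCount (λ S → ∃ λ w → Leaves (mark c u) T u (h ∷ ps) w S) k ×
              own u * k ≡ formula-at (mark c u) u
    next zero    bound cu _  with () ← mark-bound c _ cu bound
    next (suc f) bound cu hu = pathCount f (extend st cu hu) (s≤s⁻¹ (mark-bound c _ cu bound))

-- Subsets as colourings

member : Bool → Colour
member true  = tree
member false = free

member≢path : ∀ x → member x ≢ path
member≢path true  ()
member≢path false ()

number-member : (V : Subset n) → number tree (member ∘ lookup V) ≡ ∣ V ∣
number-member []          = refl
number-member (true ∷ V)  = cong suc (number-member V)
number-member (false ∷ V) = number-member V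

number-nonmember : (V : Subset n) → number free (member ∘ lookup V) ≡ n ∸ ∣ V ∣
number-nonmember {n} V = begin
  number free f                                 ≡⟨ m+n∸m≡n (number tree f) _ ⟨
  number tree f + number free f ∸ number tree f ≡⟨ cong₂ _∸_ (number-total-pathless f (member≢path ∘ lookup V)) (number-member V) ⟩
  n ∸ ∣ V ∣                                     ∎
  where
  open ≡-Reasoning
  f = member ∘ lookup V

membership : Subset m → Subset n → Colouring m n
membership VX VY (inj₁ i) = member (lookup VX i)
membership VX VY (inj₂ j) = member (lookup VY j)

membership-pathless : (VX : Subset m) (VY : Subset n) → ∀ x → membership VX VY x ≢ path
membership-pathless VX VY (inj₁ i) = member≢path (lookup VX i)
membership-pathless VX VY (inj₂ j) = member≢path (lookup VY j)

inV⇒tree : ∀ {VX : Subset m} {VY : Subset n} u → InV VX VY u → membership VX VY u ≡ tree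
inV⇒tree (inj₁ i) i∈VX = cong member ([]=⇒lookup i∈VX)
inV⇒tree (inj₂ j) j∈VY = cong member ([]=⇒lookup j∈VY)

tree⇒inV : ∀ {VX : Subset m} {VY : Subset n} u → membership VX VY u ≡ tree → InV VX VY u
tree⇒inV {VX = VX} (inj₁ i) eq with lookup VX i in i∈VX
... | true = lookup⇒[]= i VX i∈VX
tree⇒inV {VY = VY} (inj₂ j) eq with lookup VY j in j∈VY
... | true = lookup⇒[]= j VY j∈VY

-- A walk in `T` stays in its vertex set, because each vertex before the last is an end of an edge
-- of `T`.
isTree⇒tree : ∀ {VX : Subset m} {VY : Subset n} {T} → IsTree VX VY T →
  Tree (λ x → membership VX VY x ≡ tree) T
isTree⇒tree {m} {n} {VX} {VY} {T} (edges , _ , connected , acyc) = record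
  { inside  = λ u v e → inV⇒tree u (endpoint u v e)
  ; conn    = λ {u} {v} cu cv → walk (inV⇒tree v (tree⇒inV v cv)) (connected u v (tree⇒inV u cu) (tree⇒inV v cv))
  ; acyclic = acyc
  }
  where
  endpoint : ∀ u v → Adj T u v → InV VX VY u
  endpoint (inj₁ i) (inj₂ j) e = proj₁ (edges i j e)
  endpoint (inj₂ j) (inj₁ i) e = proj₂ (edges i j e)
  walk : ∀ {u v} → membership VX VY v ≡ tree → Reach T u v → Walk T (λ x → membership VX VY x ≡ tree) u v
  walk cv here                   = stop cv
  walk cv (step {u} {w} e reach) = go (inV⇒tree u (endpoint u w e)) e (walk cv reach)

-- Closed form of the counts and their ratios

count-formula : ∀ {m n s t k} {VX : Subset (suc m)} {VY : Subset (suc n)} {T} →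
  IsTree VX VY T → ∣ VX ∣ ≡ s → ∣ VY ∣ ≡ t → NumSpanningTreesContaining T k →
  suc n * (suc m * k) ≡ formula (suc m) (suc n) s t (suc m ∸ s) (suc n ∸ t) ×
  suc m * (suc n * k) ≡ formula (suc n) (suc m) t s (suc n ∸ t) (suc m ∸ s)
count-formula {VX = VX} {VY} isT@(_ , (u , u∈V) , _) refl refl counted
  with k , counted′ , value ← treeCount _ (isTree⇒tree isT) (u , inV⇒tree u u∈V) (membership-pathless VX VY) ≤-refl
  -- The given count `k` is identified with the one constructed by the induction.
  with refl ← count-unique counted counted′
  -- The two equations are the same value seen from a vertex of X and from a vertex of Y.
  with valueX ← value (inj₁ zero) | valueY ← value (inj₂ zero)
  rewrite number-member VX | number-member VY | number-nonmember VX | number-nonmember VY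
  = valueX , valueY

-- With `b` vertices left after `t + 1`, the linear factors are `M * (t + 1) + s * b = s * N + (M ∸
-- s) * (t + 1)` and `M * t + s * (b + 1) = s * N + (M ∸ s) * t`. The smaller tree leaves one more
-- vertex free, whence the extra factor `M`.
ratio : ∀ M N s t k k′ .{{_ : NonZero M}} .{{_ : NonZero N}} → s ≤ M → suc t ≤ N →
  N * (M * k)  ≡ formula M N s t (M ∸ s) (N ∸ t) →
  N * (M * k′) ≡ formula M N s (suc t) (M ∸ s) (N ∸ suc t) →
  k′ * (M * (s * N + (M ∸ s) * t)) ≡ k * (s * N + (M ∸ s) * (t + 1))
ratio M N s t k k′ s≤M t<N eq eq′ = *-cancelˡ-≡ _ _ M (*-cancelˡ-≡ _ _ N (begin
  N * (M * (k′ * (M * (s * N + a * t))))     ≡⟨ regroup N M k′ _ ⟩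
  N * (M * k′) * (M * (s * N + a * t))       ≡⟨ cong (_* (M * (s * N + a * t))) eq′ ⟩
  formula M N s (suc t) a b * (M * (s * N + a * t))
    ≡⟨ subst (λ (M , N) → ((M * suc t + s * b) * (x * y)) * (M * (s * N + a * t)) ≡
                          ((M * t + s * suc b) * (x * (M * y))) * (s * N + a * (t + 1)))
         (cong₂ _,_ (m+[n∸m]≡n s≤M) (m+[n∸m]≡n t<N)) (identity s a t b x y) ⟩
  formula M N s t a (suc b) * (s * N + a * (t + 1))
    -- Since `t < N`, `N ∸ t` is the successor of `N ∸ suc t`.
    ≡⟨ cong (λ b → formula M N s t a b * (s * N + a * (t + 1))) (+-∸-assoc 1 t<N) ⟨
  formula M N s t a (N ∸ t) * (s * N + a * (t + 1)) ≡⟨ cong (_* (s * N + a * (t + 1))) eq ⟨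
  N * (M * k) * (s * N + a * (t + 1))        ≡⟨ regroup N M k _ ⟨
  N * (M * (k * (s * N + a * (t + 1))))      ∎))
  where
  open ≡-Reasoning
  a = M ∸ s
  b = N ∸ suc t
  x = N ^ a
  y = M ^ b
  regroup : ∀ N M k z → N * (M * (k * z)) ≡ N * (M * k) * z
  regroup = solve-∀
  identity : ∀ s a t b x y →
    (((s + a) * suc t + s * b) * (x * y)) * ((s + a) * (s * (suc t + b) + a * t)) ≡
    (((s + a) * t + s * suc b) * (x * ((s + a) * y))) * (s * (suc t + b) + a * (t + 1))
  identity = solve-∀

theorem4p1 : (∀ (m n s t : ℕ) → 1 ≤ s → s ≤ m → 1 ≤ t → t ≤ n ∸ 1 →
    (VX : Subset m) (VY : Subset n) (T : Edges m n) →
    IsTree VX VY T → ∣ VX ∣ ≡ s → ∣ VY ∣ ≡ t →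
    (VX′ : Subset m) (VY′ : Subset n) (T′ : Edges m n) →
    IsTree VX′ VY′ T′ → ∣ VX′ ∣ ≡ s → ∣ VY′ ∣ ≡ suc t →
    (k k′ : ℕ) → NumSpanningTreesContaining T k → NumSpanningTreesContaining T′ k′ →
    k′ * (m * (s * n + (m ∸ s) * t)) ≡ k * (s * n + (m ∸ s) * (t + 1)))
    ×
    (∀ (m n s t : ℕ) → 1 ≤ s → s ≤ m ∸ 1 → 1 ≤ t → t ≤ n →
    (VX : Subset m) (VY : Subset n) (T : Edges m n) →
    IsTree VX VY T → ∣ VX ∣ ≡ s → ∣ VY ∣ ≡ t →
    (VX′ : Subset m) (VY′ : Subset n) (T′ : Edges m n) →
    IsTree VX′ VY′ T′ → ∣ VX′ ∣ ≡ suc s → ∣ VY′ ∣ ≡ t →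
    (k k′ : ℕ) → NumSpanningTreesContaining T k → NumSpanningTreesContaining T′ k′ →
    k′ * (n * (t * m + (n ∸ t) * s)) ≡ k * (t * m + (n ∸ t) * (s + 1)))
theorem4p1 = part₁ , part₂
  where
  part₁ : _
  part₁ (suc m) (suc n) s t _ s≤m _ t≤n VX VY T isT VX≡ VY≡ VX′ VY′ T′ isT′ VX′≡ VY′≡ k k′ num num′ =
    -- The bound `t ≤ suc n ∸ 1` reduces to `t ≤ n`, which is `suc t ≤ suc n` after `s≤s`.
    ratio (suc m) (suc n) s t k k′ s≤m (s≤s t≤n)
      (proj₁ (count-formula isT VX≡ VY≡ num)) (proj₁ (count-formula isT′ VX′≡ VY′≡ num′))
  part₁ zero    _    zero    _       () z≤n
  part₁ (suc _) zero _       zero    _  _ ()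
  part₂ : _
  part₂ (suc m) (suc n) s t _ s≤m _ t≤n VX VY T isT VX≡ VY≡ VX′ VY′ T′ isT′ VX′≡ VY′≡ k k′ num num′ =
    -- The second ratio is the first with X and Y exchanged, so the equations seen from Y are used.
    ratio (suc n) (suc m) t s k k′ t≤n (s≤s s≤m)
      (proj₂ (count-formula isT VX≡ VY≡ num)) (proj₂ (count-formula isT′ VX′≡ VY′≡ num′))
  part₂ zero    _    zero    _       () z≤n
  part₂ (suc _) zero _       zero    _  _ ()
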